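{- Let $D$ be a strongly connected digraph that contains no subdivision of the oriented cycle $C(1,1,1,1,1,1)$ as a subdigraph. Then $\chi(D)\le 7\cdot 16^2$.
   Context: All graphs are simple. The chromatic number $\chi(D)$ of a digraph is the chromatic number of its underlying undirected graph. $C(1,1,1,1,1,1)$ is the oriented cycle of length $6$ whose six blocks (maximal directed subpaths) all have length $1$, i.e. the antidirected cycle of length $6$. A subdivision of a digraph $H$ is a digraph obtained from $H$ by replacing each arc $(x,y)$ by a directed path from $x$ to $y$ of length at least $1$, the new paths being internally disjoint. -}

module Defs where

open import Data.Nat using (ℕ)
open import Data.Fin using (Fin)
open import Data.Bool using (Bool; true; false)
open import Data.List using (List; []; _∷_; _++_)
open import Data.List.Relation.Unary.Unique.Propositional using (Unique)
open import Data.Product using (Σ; ∃; _×_; _,_)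
open import Relation.Binary.PropositionalEquality using (_≡_; _≢_)
open import Relation.Binary.Construct.Closure.ReflexiveTransitive using (Star)

-- A finite simple digraph on vertex set Fin n: arc relation given by a Boolean
-- adjacency function, with no loops (parallel arcs are impossible by construction;
-- opposite arcs x→y and y→x are allowed).
record Digraph (n : ℕ) : Set where
  field
    arc      : Fin n → Fin n → Bool
    loopless : ∀ x → arc x x ≡ false

open Digraph public

Arc : ∀ {n} → Digraph n → Fin n → Fin n → Set
Arc D x y = arc D x y ≡ true

StronglyConnected : ∀ {n} → Digraph n → Set
StronglyConnected {n} D = ∀ (u v : Fin n) → Star (Arc D) u v

-- DiWalk D x y is : a directed walk x → z₁ → … → zₖ → y of length ≥ 1 whose
-- internal vertices, in order, are the list is = z₁ ∷ … ∷ zₖ.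
data DiWalk {n} (D : Digraph n) : Fin n → Fin n → List (Fin n) → Set where
  edge : ∀ {x y} → Arc D x y → DiWalk D x y []
  cons : ∀ {x z y is} → Arc D x z → DiWalk D z y is → DiWalk D x y (z ∷ is)

-- D contains a subdivision of C(1,1,1,1,1,1) (the antidirected 6-cycle
-- a₀→a₁←a₂→a₃←a₄→a₅←a₀) as a subdigraph: six distinct branch vertices and
-- six directed paths a₀⇝a₁, a₂⇝a₁, a₂⇝a₃, a₄⇝a₃, a₄⇝a₅, a₀⇝a₅ (each of length
-- ≥ 1) such that all branch vertices and all internal vertices are pairwise
-- distinct (so each walk is a path and the paths are internally disjoint).
ContainsSubdivC111111 : ∀ {n} → Digraph n → Set
ContainsSubdivC111111 {n} D =
  Σ (Fin n) λ a₀ → Σ (Fin n) λ a₁ → Σ (Fin n) λ a₂ →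
  Σ (Fin n) λ a₃ → Σ (Fin n) λ a₄ → Σ (Fin n) λ a₅ →
  Σ (List (Fin n)) λ p₁ → Σ (List (Fin n)) λ p₂ → Σ (List (Fin n)) λ p₃ →
  Σ (List (Fin n)) λ p₄ → Σ (List (Fin n)) λ p₅ → Σ (List (Fin n)) λ p₆ →
    DiWalk D a₀ a₁ p₁ × DiWalk D a₂ a₁ p₂ × DiWalk D a₂ a₃ p₃ ×
    DiWalk D a₄ a₃ p₄ × DiWalk D a₄ a₅ p₅ × DiWalk D a₀ a₅ p₆ ×
    Unique (a₀ ∷ a₁ ∷ a₂ ∷ a₃ ∷ a₄ ∷ a₅ ∷ (p₁ ++ p₂ ++ p₃ ++ p₄ ++ p₅ ++ p₆))

ChromaticAtMost : ∀ {n} → Digraph n → ℕ → Set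
ChromaticAtMost {n} D k =
  Σ (Fin n → Fin k) λ c → ∀ x y → Arc D x y → c x ≢ c y

{-# OPTIONS --safe #-}
module Submission where

-- Fix a breadth-first out-tree T with level function l. An arc raises the level by at most one,
-- and the arcs that raise it are 2-coloured by the parity of l. The other arcs are split in two
-- acyclic classes by ordering the vertices lexicographically by l and then by ± index; in each
-- class arcs point downwards. Mark the arcs from every vertex to its two lowest out-neighbours.
-- Marked arcs have out-degree at most 2, hence are greedily 3-coloured. Unmarked arcs have
-- in-degree at most 3, hence are greedily 4-coloured: suppose x₁, …, x₄ are in-neighbours of y,
-- each having two out-neighbours not above y. If out-neighbours u of xᵢ and w of xⱼ are incomparable
-- in T, then u ← xᵢ → y ← xⱼ → w is closed to an antidirected 6-cycle by the tree paths from
-- the last common ancestor of u and w. Otherwise the pairs of three of the x's lie on a single branch of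
-- T, and for suitable i, k, j and w ⊑ v ⊏ v′ ⊑ u on this branch the required subdivision is
-- xᵢ → w ⇝ v ← xₖ → v′ ⇝ u ← xⱼ → y ← xᵢ. Altogether 2 · (3 · 4)² = 288 colours suffice.

open import Defs
open import Data.Nat using (ℕ; zero; suc; _+_; _*_; _^_; _∸_; _≤_; _<_; z≤n; s≤s; _≤?_; _<?_; s≤s⁻¹)
open import Data.Nat.Properties
  using ( ≤-refl; ≤-trans; ≤-antisym; ≤-total; <-irrefl; <-cmp; <⇒≤; <⇒≢; <⇒≱; <-≤-trans; ≤-<-trans
        ; ≮⇒≥; ≰⇒>; ≤ᵇ⇒≤; n≤1+n; m≤m+n; m≤n+m; m≤n⇒m<n∨m≡n; +-comm; +-monoʳ-<; *-monoˡ-≤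
        ; +-∸-assoc; m∸n≤m; n∸n≡0; m≤n⇒m∸n≡0; m∸n+n≡m; m∸[m∸n]≡n; ∸-monoʳ-≤; ∸-monoʳ-<
        ; module ≤-Reasoning)
open import Data.Fin using (Fin; zero; suc; toℕ; combine; inject≤; opposite; _≟_)
open import Data.Fin.Patterns using (0F; 1F; 2F; 3F)
open import Data.Fin.Properties
  using (any?; toℕ<n; toℕ-injective; opposite-prop; combine-injective; inject≤-injective)
open import Data.Bool using () renaming (_≟_ to _≟ᵇ_)
open import Data.List using (List; []; _∷_; _++_)
open import Data.List.Relation.Unary.All using (All; []; _∷_)
open import Data.List.Relation.Unary.All.Properties using () renaming (++⁺ to All-++⁺)
open import Data.List.Relation.Unary.AllPairs using ([]; _∷_)
open import Data.List.Relation.Unary.Unique.Propositional using (Unique)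
open import Data.Product using (Σ; ∃; _×_; _,_; proj₁; proj₂)
open import Data.Sum using (_⊎_; inj₁; inj₂; [_,_]′)
open import Data.Empty using (⊥; ⊥-elim)
open import Function using (_∘_; id)
open import Function.Definitions using (Injective)
open import Level using (0ℓ)
open import Relation.Binary.Core using (Rel)
open import Relation.Binary.Definitions using (Decidable; tri<; tri≈; tri>)
open import Relation.Binary.Construct.Closure.ReflexiveTransitive using (Star; ε; _◅_)
open import Relation.Binary.PropositionalEquality
  using (_≡_; _≢_; refl; sym; trans; cong; subst; ≢-sym; module ≡-Reasoning)
open import Relation.Nullary using (¬_; Dec; yes; no; contradiction)
open import Relation.Nullary.Decidable using (¬?; _×-dec_; _⊎-dec_)

-- Colourings of binary relations on Fin n

Colourable : ∀ {n} → Rel (Fin n) 0ℓ → ℕ → Set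
Colourable {n} R k = Σ (Fin n → Fin k) λ c → ∀ {x y} → R x y → c x ≢ c y

colourable-⊎ : ∀ {n k l} {P R S : Rel (Fin n) 0ℓ} → (∀ {x y} → P x y → R x y ⊎ S x y) →
               Colourable R k → Colourable S l → Colourable P (k * l)
colourable-⊎ split (c , proper) (d , proper′) = (λ v → combine (c v) (d v)) , λ {x} {y} p eq →
  let c≡ , d≡ = combine-injective (c x) (d x) (c y) (d y) eq
  in [ (λ r → proper r c≡) , (λ s → proper′ s d≡) ]′ (split p)

colourable-flip : ∀ {n k} {R : Rel (Fin n) 0ℓ} → Colourable (λ x y → R y x) k → Colourable R k
colourable-flip (c , proper) = c , λ r → ≢-sym (proper r)

colourable-≤ : ∀ {n k l} {R : Rel (Fin n) 0ℓ} → k ≤ l → Colourable R k → Colourable R l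
colourable-≤ k≤l (c , proper) =
  (λ v → inject≤ (c v) k≤l) , λ r eq → proper r (inject≤-injective _ _ _ _ eq)

module Greedy {n d : ℕ} {R : Rel (Fin n) 0ℓ} (R? : Decidable R)
  (key : Fin n → ℕ) (decreasing : ∀ {x y} → R x y → key y < key x)
  (degree : ∀ x (f : Fin (suc d) → Fin n) → Injective _≡_ _≡_ f → ¬ (∀ i → R x (f i))) where

  -- Pigeonhole: if every colour occurred on an out-neighbour of `x`, choosing one such neighbour
  -- per colour would inject `Fin (suc d)` into the out-neighbours, against `degree`.
  fresh : (c : Fin n → Fin (suc d)) → ∀ x → ∃ λ j → ∀ {y} → R x y → c y ≢ j
  fresh c x with any? (λ j → ¬? (any? λ y → R? x y ×-dec (c y ≟ j)))
  ... | yes (j , unused) = j , λ r c≡ → unused (_ , r , c≡)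
  ... | no allUsed = ⊥-elim (degree x (proj₁ ∘ used) injective (proj₁ ∘ proj₂ ∘ used))
    where
    used : ∀ j → ∃ λ y → R x y × c y ≡ j
    used j with any? (λ y → R? x y ×-dec (c y ≟ j))
    ... | yes u = u
    ... | no ¬u = contradiction (j , ¬u) allUsed
    injective : Injective _≡_ _≡_ (proj₁ ∘ used)
    injective {i} {j} eq =
      trans (sym (proj₂ (proj₂ (used i)))) (trans (cong c eq) (proj₂ (proj₂ (used j))))

  -- Vertices are coloured in order of key. The step recolours all keys from `b` on; an
  -- out-neighbour of a vertex of key `b` has smaller key, so it retains the colour that `fresh`
  -- avoided.
  below : ∀ b → Σ (Fin n → Fin (suc d)) λ c → ∀ {x y} → key x < b → R x y → c x ≢ c y
  below zero = (λ _ → zero) , λ ()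
  below (suc b) = c′ , λ {x} {y} → proper′ x y
    where
    c = proj₁ (below b)
    proper = proj₂ (below b)
    c′ : Fin n → Fin (suc d)
    c′ x with key x <? b
    ... | yes _ = c x
    ... | no _ = proj₁ (fresh c x)
    proper′ : ∀ x y → key x < suc b → R x y → c′ x ≢ c′ y
    proper′ x y (s≤s kx≤b) r with key x <? b | key y <? b
    ... | yes kx<b | yes _ = proper kx<b r
    ... | no _ | yes _ = ≢-sym (proj₂ (fresh c x) r)
    ... | _ | no ky≮b = contradiction (<-≤-trans (decreasing r) kx≤b) ky≮b

upperBound : ∀ {n} (f : Fin n → ℕ) → ∃ λ b → ∀ i → f i ≤ b
upperBound {zero} f = 0 , λ ()
upperBound {suc n} f with upperBound (f ∘ suc)
... | b , f≤b = f zero + b , λ where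
  zero → m≤m+n _ b
  (suc i) → ≤-trans (f≤b i) (m≤n+m b _)

greedy : ∀ {n d} {R : Rel (Fin n) 0ℓ} → Decidable R →
         (key : Fin n → ℕ) → (∀ {x y} → R x y → key y < key x) →
         (∀ x (f : Fin (suc d) → Fin n) → Injective _≡_ _≡_ f → ¬ (∀ i → R x (f i))) →
         Colourable R (suc d)
greedy R? key decreasing degree with upperBound key
... | b , key≤b with Greedy.below R? key decreasing degree (suc b)
... | c , proper = c , proper (s≤s (key≤b _))

greedyFlip : ∀ {n d} {R : Rel (Fin n) 0ℓ} → Decidable R →
             (key : Fin n → ℕ) → (∀ {x y} → R x y → key y < key x) →
             (∀ y (f : Fin (suc d) → Fin n) → Injective _≡_ _≡_ f → ¬ (∀ i → R (f i) y)) →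
             Colourable R (suc d)
greedyFlip R? key decreasing degree with upperBound key
... | b , key≤b = colourable-flip
  -- In the reversed order each vertex is coloured after its in-neighbours. Up to the bound `b`,
  -- truncated subtraction strictly reverses `key`.
  (greedy (λ x y → R? y x) (λ v → b ∸ key v) (λ r → ∸-monoʳ-< (decreasing r) (key≤b _)) degree)

flip₂ : Fin 2 → Fin 2
flip₂ zero = suc zero
flip₂ (suc zero) = zero

parity : ℕ → Fin 2
parity zero = zero
parity (suc m) = flip₂ (parity m)

parity-suc : ∀ m → parity (suc m) ≢ parity m
parity-suc m with parity m
... | zero = λ ()
... | suc zero = λ ()

-- Breadth-first search trees

-- The root is present only as the vertex of level 0, and `parent` is constrained only at positive
-- levels. `level-arc` is what makes the tree breadth-first.
record BFSTree {n} (D : Digraph n) : Set where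
  field
    level : Fin n → ℕ
    parent : Fin n → Fin n
    root-unique : ∀ {u v} → level u ≡ 0 → level v ≡ 0 → u ≡ v
    parent-arc : ∀ {v j} → level v ≡ suc j → Arc D (parent v) v
    level-parent : ∀ {v j} → level v ≡ suc j → level (parent v) ≡ j
    level-arc : ∀ {x y} → Arc D x y → level y ≤ suc (level x)

least : ∀ {P : ℕ → Set} → (∀ k → Dec (P k)) → ∀ {k} → P k →
        ∃ λ m → P m × (∀ {j} → P j → m ≤ j)
least P? {k} pk with P? 0
... | yes p0 = 0 , p0 , λ _ → z≤n
least P? {zero} p0 | no ¬p0 = contradiction p0 ¬p0
least {P} P? {suc k} pk | no ¬p0 with least (P? ∘ suc) pk
... | m , pm , minimal = suc m , pm , λ {j} → minimal′ j
  where
  minimal′ : ∀ j → P j → suc m ≤ j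
  minimal′ zero p0 = contradiction p0 ¬p0
  minimal′ (suc j) pj = s≤s (minimal pj)

arc? : ∀ {n} (D : Digraph n) → Decidable (Arc D)
arc? D x y = arc D x y ≟ᵇ _

arc⇒≢ : ∀ {n} (D : Digraph n) {x y} → Arc D x y → x ≢ y
arc⇒≢ D {x} a refl with trans (sym a) (loopless D x)
... | ()

module BFS {n} (D : Digraph n) (r : Fin n) (reach : ∀ v → Star (Arc D) r v) where

  -- Walks grow at their far end, so that the vertex before `v`, the future parent, can be read off.
  ReachIn : ℕ → Fin n → Set
  ReachIn zero v = r ≡ v
  ReachIn (suc k) v = ∃ λ u → ReachIn k u × Arc D u v

  reachIn? : ∀ v k → Dec (ReachIn k v)
  reachIn? v zero = r ≟ v
  reachIn? v (suc k) = any? λ u → reachIn? u k ×-dec arc? D u v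

  follow : ∀ {u v k} → ReachIn k u → Star (Arc D) u v → ∃ λ l → ReachIn l v
  follow p ε = _ , p
  follow p (a ◅ as) = follow (_ , p , a) as

  distance : ∀ v → ∃ λ m → ReachIn m v × (∀ {j} → ReachIn j v → m ≤ j)
  distance v = least (reachIn? v) (proj₂ (follow refl (reach v)))

  dist : Fin n → ℕ
  dist v = proj₁ (distance v)

  shortest : ∀ v → ReachIn (dist v) v
  shortest v = proj₁ (proj₂ (distance v))

  dist-minimal : ∀ {v j} → ReachIn j v → dist v ≤ j
  dist-minimal {v} = proj₂ (proj₂ (distance v))

  last : ∀ k {v} → ReachIn k v → Fin n
  last zero _ = r
  last (suc _) (u , _) = u

  predecessor : ∀ {v j} k (p : ReachIn k v) → k ≡ suc j → ReachIn j (last k p) × Arc D (last k p) v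
  predecessor (suc _) (u , p , a) refl = p , a

  dist-arc : ∀ {x y} → Arc D x y → dist y ≤ suc (dist x)
  dist-arc {x} a = dist-minimal (x , shortest x , a)

  tree : BFSTree D
  tree = record
    { level = dist
    ; parent = λ v → last (dist v) (shortest v)
    ; root-unique = λ {u} {v} u0 v0 →
        trans (sym (subst (λ k → ReachIn k u) u0 (shortest u))) (subst (λ k → ReachIn k v) v0 (shortest v))
    ; parent-arc = λ {v} eq → proj₂ (predecessor (dist v) (shortest v) eq)
    -- Dropping the last arc of a shortest walk bounds the distance of the parent from above;
    -- `dist-arc` bounds it from below.
    ; level-parent = λ {v} eq →
        let p , a = predecessor (dist v) (shortest v) eq
        in ≤-antisym (dist-minimal p) (s≤s⁻¹ (subst (_≤ suc (dist (last (dist v) (shortest v)))) eq (dist-arc a)))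
    ; level-arc = dist-arc
    }

-- Ancestor order and tree paths

module Tree {n} {D : Digraph n} (T : BFSTree D) where
  open BFSTree T

  ancestor : ℕ → Fin n → Fin n
  ancestor zero v = v
  ancestor (suc j) v = parent (ancestor j v)

  -- Mutual with `level-ancestor-suc`: a `parent` step is known to lower the level only where the
  -- level is a successor.
  level-ancestor : ∀ j {v} → j ≤ level v → level (ancestor j v) ≡ level v ∸ j
  level-ancestor-suc : ∀ j {v} → suc j ≤ level v → level (ancestor j v) ≡ suc (level v ∸ suc j)

  level-ancestor zero _ = refl
  level-ancestor (suc j) j<l = level-parent (level-ancestor-suc j j<l)

  level-ancestor-suc j j<l = trans (level-ancestor j (<⇒≤ j<l)) (+-∸-assoc 1 j<l)

  ancestor-arc : ∀ j {v} → suc j ≤ level v → Arc D (ancestor (suc j) v) (ancestor j v)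
  ancestor-arc j j<l = parent-arc (level-ancestor-suc j j<l)

  ancestor-+ : ∀ i j v → ancestor i (ancestor j v) ≡ ancestor (i + j) v
  ancestor-+ zero j v = refl
  ancestor-+ (suc i) j v = cong parent (ancestor-+ i j v)

  -- If level u > level v then u ⊑ v reduces to v ≡ u, hence is false.
  _⊑_ : Fin n → Fin n → Set
  u ⊑ v = ancestor (level v ∸ level u) v ≡ u

  _⊑?_ : Decidable _⊑_
  u ⊑? v = ancestor (level v ∸ level u) v ≟ u

  ancestor-⊑ : ∀ j {v} → j ≤ level v → ancestor j v ⊑ v
  ancestor-⊑ j {v} j≤l rewrite level-ancestor j j≤l | m∸[m∸n]≡n j≤l = refl

  ⊑-refl : ∀ {v} → v ⊑ v
  ⊑-refl = ancestor-⊑ 0 z≤n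

  ⊑⇒level≤ : ∀ {u v} → u ⊑ v → level u ≤ level v
  ⊑⇒level≤ {u} {v} p =
    subst (_≤ level v) (trans (sym (level-ancestor _ (m∸n≤m _ (level u)))) (cong level p))
      (m∸n≤m _ (level v ∸ level u))

  ⊑∧level≥⇒≡ : ∀ {u v} → u ⊑ v → level v ≤ level u → v ≡ u
  ⊑∧level≥⇒≡ {u} {v} p l≤ = trans (cong (λ k → ancestor k v) (sym (m≤n⇒m∸n≡0 l≤))) p

  ⊑∧≢⇒level< : ∀ {u v} → u ⊑ v → u ≢ v → level u < level v
  ⊑∧≢⇒level< p u≢v = ≰⇒> λ l≤ → u≢v (sym (⊑∧level≥⇒≡ p l≤))

  ∸-telescope : ∀ {a b c} → a ≤ b → b ≤ c → (b ∸ a) + (c ∸ b) ≡ c ∸ a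
  ∸-telescope {a} {b} {c} a≤b b≤c = begin
    (b ∸ a) + (c ∸ b) ≡⟨ +-comm (b ∸ a) _ ⟩
    (c ∸ b) + (b ∸ a) ≡⟨ +-∸-assoc (c ∸ b) a≤b ⟨
    (c ∸ b + b) ∸ a   ≡⟨ cong (_∸ a) (m∸n+n≡m b≤c) ⟩
    c ∸ a             ∎
    where open ≡-Reasoning

  -- The climb from `w` to the level of `u` passes through `v`. This yields both transitivity and
  -- the comparability of two ancestors of one vertex.
  ancestor-∸ : ∀ {u v w} → v ⊑ w → level u ≤ level v →
               ancestor (level v ∸ level u) v ≡ ancestor (level w ∸ level u) w
  ancestor-∸ {u} {v} {w} p l≤ = begin
    ancestor (level v ∸ level u) v                                  ≡⟨ cong (ancestor (level v ∸ level u)) p ⟨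
    ancestor (level v ∸ level u) (ancestor (level w ∸ level v) w)   ≡⟨ ancestor-+ (level v ∸ level u) _ w ⟩
    ancestor ((level v ∸ level u) + (level w ∸ level v)) w          ≡⟨ cong (λ k → ancestor k w)
                                                                             (∸-telescope l≤ (⊑⇒level≤ p)) ⟩
    ancestor (level w ∸ level u) w                                  ∎
    where open ≡-Reasoning

  ⊑-trans : ∀ {u v w} → u ⊑ v → v ⊑ w → u ⊑ w
  ⊑-trans p q = trans (sym (ancestor-∸ q (⊑⇒level≤ p))) p

  Comparable : Fin n → Fin n → Set
  Comparable u v = u ⊑ v ⊎ v ⊑ u

  comparable? : Decidable Comparable
  comparable? u v = (u ⊑? v) ⊎-dec (v ⊑? u)

  comparable∧level≤⇒⊑ : ∀ {u v} → Comparable u v → level u ≤ level v → u ⊑ v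
  comparable∧level≤⇒⊑ (inj₁ p) _ = p
  comparable∧level≤⇒⊑ (inj₂ q) l≤ with refl ← ⊑∧level≥⇒≡ q l≤ = ⊑-refl

  ancestors-comparable : ∀ {u v w} → u ⊑ w → v ⊑ w → Comparable u v
  ancestors-comparable {u} {v} p q with ≤-total (level u) (level v)
  ... | inj₁ l≤ = inj₁ (trans (ancestor-∸ q l≤) p)
  ... | inj₂ l≤ = inj₂ (trans (ancestor-∸ p l≤) q)

  -- The tree path from `ancestor j v` down to `v` without its end `v`: the internal vertices of a
  -- walk that enters this path by an arc from another vertex.
  trail : ℕ → Fin n → List (Fin n)
  trail zero v = []
  trail (suc j) v = ancestor (suc j) v ∷ trail j v

  trail-walk : ∀ {x} j {v} → j ≤ level v → Arc D x (ancestor j v) → DiWalk D x v (trail j v)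
  trail-walk zero _ a = edge a
  trail-walk (suc j) j<l a = cons a (trail-walk j (<⇒≤ j<l) (ancestor-arc j j<l))

  trail-All : ∀ {P : Fin n → Set} j {v} → (∀ i → suc i ≤ j → P (ancestor (suc i) v)) → All P (trail j v)
  trail-All zero p = []
  trail-All (suc j) p = p j ≤-refl ∷ trail-All j λ i i<j → p i (≤-trans i<j (n≤1+n j))

  level-ancestor-< : ∀ i j {v} → i < j → j ≤ level v → level (ancestor j v) < level (ancestor i v)
  level-ancestor-< i j i<j j≤l
    rewrite level-ancestor j j≤l | level-ancestor i (≤-trans (<⇒≤ i<j) j≤l) = ∸-monoʳ-< i<j j≤l

  ancestor-≢ : ∀ i j {v} → i < j → j ≤ level v → ancestor j v ≢ ancestor i v
  ancestor-≢ i j i<j j≤l eq = <⇒≢ (level-ancestor-< i j i<j j≤l) (cong level eq)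

  trail-++-Unique : ∀ j {v ys} → j ≤ level v → (∀ i → suc i ≤ j → All (ancestor (suc i) v ≢_) ys) →
                    Unique ys → Unique (trail j v ++ ys)
  trail-++-Unique zero _ _ uys = uys
  trail-++-Unique (suc j) j<l apart uys =
    All-++⁺ (trail-All j λ i i<j → ancestor-≢ (suc i) (suc j) (s≤s i<j) j<l) (apart j ≤-refl)
    ∷ trail-++-Unique j (<⇒≤ j<l) (λ i i<j → apart i (≤-trans i<j (n≤1+n j))) uys

  trail-Unique : ∀ j {v} → j ≤ level v → Unique (trail j v)
  trail-Unique zero _ = []
  trail-Unique (suc j) j<l =
    trail-All j (λ i i<j → ancestor-≢ (suc i) (suc j) (s≤s i<j) j<l) ∷ trail-Unique j (<⇒≤ j<l)

  -- A cheap certificate that `z` is no ancestor of `u`, hence lies off every tree path ending at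
  -- `u`.
  Beyond : Fin n → Fin n → Set
  Beyond u z = level u ≤ level z × z ≢ u

  beyond⇒≢ : ∀ {u z t} → Beyond u z → t ⊑ u → z ≢ t
  beyond⇒≢ (l≤ , z≢u) p refl = z≢u (sym (⊑∧level≥⇒≡ p l≤))

  -- Last common ancestors and antidirected 6-cycles

  root-level : ∀ {j v} → level v ≡ j → level (ancestor j v) ≡ 0
  root-level {v = v} refl = trans (level-ancestor (level v) ≤-refl) (n∸n≡0 (level v))

  root-⊑ : ∀ {v w} → level v ≡ 0 → v ⊑ w
  root-⊑ {w = w} v0 = subst (_⊑ w) (root-unique (root-level refl) v0) (ancestor-⊑ (level w) ≤-refl)

  -- The last common ancestor, by its distances `suc a` and `suc b` above `u` and `w`. They are
  -- positive since it differs from both, and `a`, `b` are then the trail lengths.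
  record Meet (u w : Fin n) : Set where
    field
      {a b} : ℕ
      a<level : suc a ≤ level u
      b<level : suc b ≤ level w
      meets : ancestor (suc a) u ≡ ancestor (suc b) w
      first : ∀ i → i ≤ a → ¬ ancestor i u ⊑ w

  meet : ∀ {u w} → ¬ Comparable u w → Meet u w
  meet {u} {w} incomp = go (level u) refl
    where
    go : ∀ l → level u ≡ l → Meet u w
    go zero u0 = contradiction (inj₁ (root-⊑ u0)) incomp
    -- The root, `suc c` steps above `u`, is an ancestor of `w` and guarantees that the search
    -- succeeds.
    go (suc c) uc with least (λ k → ancestor (suc k) u ⊑? w) {c} (root-⊑ (root-level uc))
    ... | a , p , minimal = finish (level w ∸ level (ancestor (suc a) u)) refl
      where
      a<l : suc a ≤ level u
      a<l = subst (suc a ≤_) (sym uc) (s≤s (minimal (root-⊑ (root-level uc))))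
      outside : ∀ i → i ≤ a → ¬ ancestor i u ⊑ w
      outside zero _ q = incomp (inj₁ q)
      outside (suc i) i<a q = <-irrefl refl (<-≤-trans i<a (minimal q))
      finish : ∀ b → level w ∸ level (ancestor (suc a) u) ≡ b → Meet u w
      -- Distance 0 would make `w` itself the common ancestor.
      finish zero eq = contradiction
        (inj₂ (subst (_⊑ u) (trans (sym p) (cong (λ k → ancestor k w) eq)) (ancestor-⊑ (suc a) a<l))) incomp
      finish (suc b) eq = record
        { a<level = a<l
        ; b<level = subst (_≤ level w) eq (m∸n≤m (level w) (level (ancestor (suc a) u)))
        ; meets = trans (sym p) (cong (λ k → ancestor k w) eq)
        ; first = outside
        }

  -- With `m` the last common ancestor, the cycle is m ⇝ u ← x → y ← z → w ⇜ m. The `Beyond`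
  -- hypotheses keep `x`, `y`, `z` off both tree paths.
  incomparable⇒C6 : ∀ {u w x y z} → ¬ Comparable u w →
    Arc D x u → Arc D x y → Arc D z y → Arc D z w → x ≢ z →
    Beyond u x → Beyond w x → Beyond u y → Beyond w y → Beyond u z → Beyond w z →
    ContainsSubdivC111111 D
  incomparable⇒C6 {u} {w} {x} {y} {z} incomp xu xy zy zw x≢z ux wx uy wy uz wz =
    m , u , x , y , z , w , trail a u , [] , [] , [] , [] , trail b w ,
    trail-walk a (<⇒≤ a<level) (ancestor-arc a a<level) , edge xu , edge xy , edge zy , edge zw ,
    subst (λ t → DiWalk D t w (trail b w)) (sym meets)
      (trail-walk b (<⇒≤ b<level) (ancestor-arc b b<level)) ,
    (m≢u 0 z≤n ∷ ≢-sym (beyond⇒≢ ux m⊑u) ∷ ≢-sym (beyond⇒≢ uy m⊑u) ∷ ≢-sym (beyond⇒≢ uz m⊑u)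
      ∷ m≢w 0 z≤n ∷ All-++⁺ (trail-All a (λ i i<a → m≢u (suc i) i<a))
                            (trail-All b (λ i i<b → m≢w (suc i) i<b)))
    ∷ (≢-sym (proj₂ ux) ∷ ≢-sym (proj₂ uy) ∷ ≢-sym (proj₂ uz)
      ∷ (λ { refl → incomp (inj₁ ⊑-refl) })
      ∷ All-++⁺ (trail-All a (λ i i<a → ≢-sym (ancestor-≢ 0 (suc i) (s≤s z≤n) (belowA i i<a))))
                (trail-All b (λ i i<b → apart 0 z≤n (suc i) i<b)))
    ∷ (arc⇒≢ D xy ∷ x≢z ∷ proj₂ wx ∷ offTrails ux wx)
    ∷ (≢-sym (arc⇒≢ D zy) ∷ proj₂ wy ∷ offTrails uy wy)
    ∷ (proj₂ wz ∷ offTrails uz wz)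
    ∷ All-++⁺ (trail-All a (λ i i<a → ≢-sym (apart (suc i) i<a 0 z≤n)))
              (trail-All b (λ i i<b → ≢-sym (ancestor-≢ 0 (suc i) (s≤s z≤n) (belowB i i<b))))
    ∷ trail-++-Unique a (<⇒≤ a<level) (λ i i<a → trail-All b (λ j j<b → apart (suc i) i<a (suc j) j<b))
        (trail-Unique b (<⇒≤ b<level))
    where
    open Meet (meet incomp)
    m = ancestor (suc a) u
    m⊑u : m ⊑ u
    m⊑u = ancestor-⊑ (suc a) a<level
    belowA : ∀ i → i < a → i < level u
    belowA i i<a = ≤-trans i<a (<⇒≤ a<level)
    belowB : ∀ i → i < b → i < level w
    belowB i i<b = ≤-trans i<b (<⇒≤ b<level)
    m≢u : ∀ i → i ≤ a → m ≢ ancestor i u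
    m≢u i i≤a = ancestor-≢ i (suc a) (s≤s i≤a) a<level
    m≢w : ∀ i → i ≤ b → m ≢ ancestor i w
    m≢w i i≤b eq = ancestor-≢ i (suc b) (s≤s i≤b) b<level (trans (sym meets) eq)
    -- A shared vertex would be an ancestor of `w` met on the way from `u` before `m`, against
    -- `first`.
    apart : ∀ i → i ≤ a → ∀ j → j ≤ b → ancestor i u ≢ ancestor j w
    apart i i≤a j j≤b eq = first i i≤a (subst (_⊑ w) (sym eq) (ancestor-⊑ j (≤-trans j≤b (<⇒≤ b<level))))
    offTrails : ∀ {t} → Beyond u t → Beyond w t → All (t ≢_) (trail a u ++ trail b w)
    offTrails ut wt = All-++⁺ (trail-All a (λ i i<a → beyond⇒≢ ut (ancestor-⊑ (suc i) (belowA i i<a))))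
                              (trail-All b (λ i i<b → beyond⇒≢ wt (ancestor-⊑ (suc i) (belowB i i<b))))

  -- The antidirected cycle is x → w ⇝ v ← z → v′ ⇝ u ← s → y ← x.
  chain⇒C6 : ∀ {u v v′ w x y z s} → w ⊑ v → v ⊑ v′ → v ≢ v′ → v′ ⊑ u →
    Arc D x w → Arc D z v → Arc D z v′ → Arc D s u → Arc D s y → Arc D x y →
    x ≢ z → z ≢ s → s ≢ x → z ≢ y →
    Beyond u x → Beyond u z → Beyond u s → Beyond u y →
    ContainsSubdivC111111 D
  chain⇒C6 {u} {v} {v′} {w} {x} {y} {z} {s} w⊑v v⊑v′ v≢v′ v′⊑u
    xw zv zv′ su sy xy x≢z z≢s s≢x z≢y ux uz us uy =
    x , v , z , u , s , y , trail j v , [] , trail k u , [] , [] , [] ,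
    trail-walk j j≤ (subst (Arc D x) (sym w⊑v) xw) , edge zv ,
    trail-walk k k≤ (subst (Arc D z) (sym v′⊑u) zv′) , edge su , edge sy , edge xy ,
    (beyond⇒≢ ux v⊑u ∷ x≢z ∷ proj₂ ux ∷ ≢-sym s≢x ∷ arc⇒≢ D xy ∷ offTrails ux)
    ∷ (≢-sym (beyond⇒≢ uz v⊑u) ∷ v≢k 0 z≤n ∷ ≢-sym (beyond⇒≢ us v⊑u) ∷ ≢-sym (beyond⇒≢ uy v⊑u)
      ∷ All-++⁺ (trail-All j (λ i i<j → ≢-sym (ancestor-≢ 0 (suc i) (s≤s z≤n) (≤-trans i<j j≤))))
                (All-++⁺ (trail-All k (λ i i<k → v≢k (suc i) i<k)) []))
    ∷ (proj₂ uz ∷ z≢s ∷ z≢y ∷ offTrails uz)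
    ∷ (≢-sym (proj₂ us) ∷ ≢-sym (proj₂ uy)
      ∷ All-++⁺ (trail-All j (λ i i<j → ≢-sym (j≢k (suc i) i<j 0 z≤n)))
                (All-++⁺ (trail-All k (λ i i<k → ≢-sym (ancestor-≢ 0 (suc i) (s≤s z≤n) (≤-trans i<k k≤)))) []))
    ∷ (arc⇒≢ D sy ∷ offTrails us)
    ∷ offTrails uy
    ∷ trail-++-Unique j j≤ (λ i i<j → All-++⁺ (trail-All k (λ l l<k → j≢k (suc i) i<j (suc l) l<k)) [])
        (trail-++-Unique k k≤ (λ _ _ → []) [])
    where
    -- Either length is 0 if the ends coincide; the path then shrinks to the single entering arc.
    j = level v ∸ level w
    k = level u ∸ level v′
    j≤ : j ≤ level v
    j≤ = m∸n≤m (level v) (level w)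
    k≤ : k ≤ level u
    k≤ = m∸n≤m (level u) (level v′)
    v⊑u : v ⊑ u
    v⊑u = ⊑-trans v⊑v′ v′⊑u
    -- Levels separate the two tree paths: one stays at or above `v` in the tree, the other at or
    -- below `v′`, which is strictly deeper.
    j≢k : ∀ i → i ≤ j → ∀ l → l ≤ k → ancestor i v ≢ ancestor l u
    j≢k i i≤j l l≤k eq = <⇒≢ (begin-strict
      level (ancestor i v)  ≤⟨ ⊑⇒level≤ (ancestor-⊑ i (≤-trans i≤j j≤)) ⟩
      level v               <⟨ ⊑∧≢⇒level< v⊑v′ v≢v′ ⟩
      level v′              ≡⟨ cong level v′⊑u ⟨
      level (ancestor k u)  ≡⟨ level-ancestor k k≤ ⟩
      level u ∸ k           ≤⟨ ∸-monoʳ-≤ (level u) l≤k ⟩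
      level u ∸ l           ≡⟨ level-ancestor l (≤-trans l≤k k≤) ⟨
      level (ancestor l u)  ∎) (cong level eq)
      where
      open ≤-Reasoning
    v≢k : ∀ l → l ≤ k → v ≢ ancestor l u
    v≢k l l≤k = j≢k 0 z≤n l l≤k
    offTrails : ∀ {t} → Beyond u t → All (t ≢_) (trail j v ++ trail k u ++ [])
    offTrails ut = All-++⁺
      (trail-All j (λ i i<j → beyond⇒≢ ut (⊑-trans (ancestor-⊑ (suc i) (≤-trans i<j j≤)) v⊑u)))
      (All-++⁺ (trail-All k (λ i i<k → beyond⇒≢ ut (ancestor-⊑ (suc i) (≤-trans i<k k≤)))) [])

-- Degrees of marked and unmarked arcs

module Marking {n} {D : Digraph n} (T : BFSTree D) (key : Fin n → ℕ)
  (key-level : ∀ {u v} → key u ≤ key v → BFSTree.level T u ≤ BFSTree.level T v) where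
  open BFSTree T
  open Tree T

  Backward : Rel (Fin n) 0ℓ
  Backward x y = Arc D x y × key y < key x

  Lower : Fin n → Fin n → Fin n → Set
  Lower x y v = Arc D x v × key v ≤ key y × v ≢ y

  lower? : ∀ x y v → Dec (Lower x y v)
  lower? x y v = arc? D x v ×-dec (key v ≤? key y) ×-dec ¬? (v ≟ y)

  TwoLower : Rel (Fin n) 0ℓ
  TwoLower x y = ∃ λ v → ∃ λ v′ → v ≢ v′ × Lower x y v × Lower x y v′

  twoLower? : Decidable TwoLower
  twoLower? x y = any? λ v → any? λ v′ → ¬? (v ≟ v′) ×-dec lower? x y v ×-dec lower? x y v′

  -- Counting replaces sorting: the head is among the two lowest out-neighbours of `x` unless two
  -- others are not above it.
  Marked Unmarked : Rel (Fin n) 0ℓ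
  Marked x y = Backward x y × ¬ TwoLower x y
  Unmarked x y = Backward x y × TwoLower x y

  backward? : Decidable Backward
  backward? x y = arc? D x y ×-dec (key y <? key x)

  -- Of three marked heads, the one of largest key has the other two as lower out-neighbours, so its
  -- arc is not marked.
  marked-degree : ∀ x (f : Fin 3 → Fin n) → Injective _≡_ _≡_ f → ¬ (∀ i → Marked x (f i))
  marked-degree x f inj marked = topmost (≤-total (k 0F) (k 1F)) (≤-total (k 1F) (k 2F)) (≤-total (k 0F) (k 2F))
    where
    k : Fin 3 → ℕ
    k i = key (f i)
    top : ∀ h i j → i ≢ j → i ≢ h → j ≢ h → k i ≤ k h → k j ≤ k h → ⊥
    top h i j i≢j i≢h j≢h i≤h j≤h = proj₂ (marked h)
      ( f i , f j , i≢j ∘ inj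
      , (proj₁ (proj₁ (marked i)) , i≤h , i≢h ∘ inj)
      , (proj₁ (proj₁ (marked j)) , j≤h , j≢h ∘ inj) )
    topmost : k 0F ≤ k 1F ⊎ k 1F ≤ k 0F → k 1F ≤ k 2F ⊎ k 2F ≤ k 1F → k 0F ≤ k 2F ⊎ k 2F ≤ k 0F → ⊥
    topmost (inj₁ 0≤1) (inj₁ 1≤2) _ = top 2F 0F 1F (λ ()) (λ ()) (λ ()) (≤-trans 0≤1 1≤2) 1≤2
    topmost (inj₁ 0≤1) (inj₂ 2≤1) _ = top 1F 0F 2F (λ ()) (λ ()) (λ ()) 0≤1 2≤1
    topmost (inj₂ 1≤0) _ (inj₁ 0≤2) = top 2F 0F 1F (λ ()) (λ ()) (λ ()) 0≤2 (≤-trans 1≤0 0≤2)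
    topmost (inj₂ 1≤0) _ (inj₂ 2≤0) = top 0F 1F 2F (λ ()) (λ ()) (λ ()) 1≤0 2≤0

  -- The two witnesses are sorted by level, so that they are comparable in the tree just when `lo`
  -- is an ancestor of `hi`.
  record Fork (x y : Fin n) : Set where
    field
      lo hi : Fin n
      lo≢hi : lo ≢ hi
      lower-lo : Lower x y lo
      lower-hi : Lower x y hi
      lo≤hi : level lo ≤ level hi

  fork : ∀ {x y} → TwoLower x y → Fork x y
  fork (v , v′ , v≢v′ , p , p′) with ≤-total (level v) (level v′)
  ... | inj₁ l≤ = record { lo≢hi = v≢v′ ; lower-lo = p ; lower-hi = p′ ; lo≤hi = l≤ }
  ... | inj₂ l≥ = record { lo≢hi = ≢-sym v≢v′ ; lower-lo = p′ ; lower-hi = p ; lo≤hi = l≥ }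

  module FourInNeighbours (avoids : ¬ ContainsSubdivC111111 D)
    (y : Fin n) (f : Fin 4 → Fin n) (inj : Injective _≡_ _≡_ f) (unmarked : ∀ i → Unmarked (f i) y) where

    open module Forks (i : Fin 4) = Fork (fork (proj₂ (unmarked i)))

    arc-y : ∀ i → Arc D (f i) y
    arc-y i = proj₁ (proj₁ (unmarked i))

    beyond-y : ∀ {i v} → Lower (f i) y v → Beyond v y
    beyond-y (_ , k≤ , v≢y) = key-level k≤ , ≢-sym v≢y

    -- The index `j` is independent of `i`: the key of `v` is at most that of `y`, which is below
    -- that of every in-neighbour `f j`.
    beyond-f : ∀ {i v} j → Lower (f i) y v → Beyond v (f j)
    beyond-f j (_ , k≤ , _) =
      let k< = ≤-<-trans k≤ (proj₂ (proj₁ (unmarked j)))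
      in key-level (<⇒≤ k<) , λ { refl → <-irrefl refl k< }

    cross : ∀ {i j v w} → i ≢ j → Lower (f i) y v → Lower (f j) y w → Comparable v w
    cross {i} {j} {v} {w} i≢j p q with comparable? v w
    ... | yes c = c
    ... | no incomp = contradiction
      (incomparable⇒C6 incomp (proj₁ p) (arc-y i) (arc-y j) (proj₁ q) (i≢j ∘ inj)
        (beyond-f i p) (beyond-f i q) (beyond-y p) (beyond-y q) (beyond-f j p) (beyond-f j q)) avoids

    Chain : Fin 4 → Set
    Chain i = lo i ⊑ hi i

    -- By `cross`, `w` is comparable with both ends of fork `i`. Were it a descendant of `lo i`,
    -- either position relative to `hi i` would make the two ends comparable.
    chain-or-below : ∀ {i j w} → i ≢ j → ¬ Chain i → Lower (f j) y w → w ⊑ lo i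
    chain-or-below {i} i≢j ¬chain q with cross i≢j (lower-lo i) q | cross i≢j (lower-hi i) q
    ... | inj₂ w⊑lo | _ = w⊑lo
    ... | inj₁ lo⊑w | inj₁ hi⊑w =
      contradiction (comparable∧level≤⇒⊑ (ancestors-comparable lo⊑w hi⊑w) (lo≤hi i)) ¬chain
    ... | inj₁ lo⊑w | inj₂ w⊑hi = contradiction (⊑-trans lo⊑w w⊑hi) ¬chain

    -- Both ends of fork `j` are ancestors of `lo i`. So at most one fork fails to be a chain, and
    -- four in-neighbours always provide three chains.
    other-chain : ∀ {i} → ¬ Chain i → ∀ j → i ≢ j → Chain j
    other-chain ¬chain j i≢j = comparable∧level≤⇒⊑
      (ancestors-comparable (chain-or-below i≢j ¬chain (lower-lo j)) (chain-or-below i≢j ¬chain (lower-hi j)))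
      (lo≤hi j)

    -- Here `lo i` ⊑ `lo k` ⊏ `hi k` ⊑ `hi j` is the branch w ⊑ v ⊏ v′ ⊑ u of `chain⇒C6`, with
    -- `f i`, `f k`, `f j` as `x`, `z`, `s`.
    middle : ∀ i k j → i ≢ k → k ≢ j → j ≢ i → Chain k →
             level (lo i) ≤ level (lo k) → level (hi k) ≤ level (hi j) → ⊥
    middle i k j i≢k k≢j j≢i chain l≤ h≤ = avoids (chain⇒C6
      (comparable∧level≤⇒⊑ (cross i≢k (lower-lo i) (lower-lo k)) l≤) chain (lo≢hi k)
      (comparable∧level≤⇒⊑ (cross k≢j (lower-hi k) (lower-hi j)) h≤)
      (proj₁ (lower-lo i)) (proj₁ (lower-lo k)) (proj₁ (lower-hi k)) (proj₁ (lower-hi j)) (arc-y j) (arc-y i)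
      (i≢k ∘ inj) (k≢j ∘ inj) (j≢i ∘ inj) (arc⇒≢ D (arc-y k))
      (beyond-f i (lower-hi j)) (beyond-f k (lower-hi j)) (beyond-f j (lower-hi j)) (beyond-y (lower-hi j)))

    -- Of the two forks other than `i`, the one whose `hi` has the smaller level is the middle one.
    lowest : ∀ i j k → i ≢ j → j ≢ k → k ≢ i → Chain j → Chain k →
             level (lo i) ≤ level (lo j) → level (lo i) ≤ level (lo k) → ⊥
    lowest i j k i≢j j≢k k≢i cj ck i≤j i≤k with ≤-total (level (hi j)) (level (hi k))
    ... | inj₁ j≤k = middle i j k i≢j j≢k k≢i cj i≤j j≤k
    ... | inj₂ k≤j = middle i k j (≢-sym k≢i) (≢-sym j≢k) (≢-sym i≢j) ck i≤k k≤j

    three-chains : ∀ i j k → i ≢ j → j ≢ k → k ≢ i → Chain i → Chain j → Chain k → ⊥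
    three-chains i j k i≢j j≢k k≢i ci cj ck
      with ≤-total (level (lo i)) (level (lo j)) | ≤-total (level (lo j)) (level (lo k))
         | ≤-total (level (lo i)) (level (lo k))
    ... | inj₁ i≤j | _ | inj₁ i≤k = lowest i j k i≢j j≢k k≢i cj ck i≤j i≤k
    ... | inj₁ i≤j | _ | inj₂ k≤i = lowest k i j k≢i i≢j j≢k ci cj k≤i (≤-trans k≤i i≤j)
    ... | inj₂ j≤i | inj₁ j≤k | _ = lowest j k i j≢k k≢i i≢j ck ci j≤k j≤i
    ... | inj₂ j≤i | inj₂ k≤j | _ = lowest k i j k≢i i≢j j≢k ci cj (≤-trans k≤j j≤i) k≤j

    impossible : ⊥
    impossible with lo 0F ⊑? hi 0F | lo 1F ⊑? hi 1F | lo 2F ⊑? hi 2F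
    ... | yes c₀ | yes c₁ | yes c₂ = three-chains 0F 1F 2F (λ ()) (λ ()) (λ ()) c₀ c₁ c₂
    ... | no ¬c | _ | _ = three-chains 1F 2F 3F (λ ()) (λ ()) (λ ())
      (other-chain ¬c 1F (λ ())) (other-chain ¬c 2F (λ ())) (other-chain ¬c 3F (λ ()))
    ... | yes _ | no ¬c | _ = three-chains 0F 2F 3F (λ ()) (λ ()) (λ ())
      (other-chain ¬c 0F (λ ())) (other-chain ¬c 2F (λ ())) (other-chain ¬c 3F (λ ()))
    ... | yes _ | yes _ | no ¬c = three-chains 0F 1F 3F (λ ()) (λ ()) (λ ())
      (other-chain ¬c 0F (λ ())) (other-chain ¬c 1F (λ ())) (other-chain ¬c 3F (λ ()))

  backward-colourable : ¬ ContainsSubdivC111111 D → Colourable Backward (3 * 4)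
  backward-colourable avoids = colourable-⊎ split
    (greedy (λ x y → backward? x y ×-dec ¬? (twoLower? x y)) key (proj₂ ∘ proj₁) marked-degree)
    (greedyFlip (λ x y → backward? x y ×-dec twoLower? x y) key (proj₂ ∘ proj₁)
      (λ y f inj unmarked → FourInNeighbours.impossible avoids y f inj unmarked))
    where
    split : ∀ {x y} → Backward x y → Marked x y ⊎ Unmarked x y
    split {x} {y} p with twoLower? x y
    ... | yes t = inj₂ (p , t)
    ... | no ¬t = inj₁ (p , ¬t)

-- Assembling the colouring

module Colouring {n} {D : Digraph n} (T : BFSTree D) (avoids : ¬ ContainsSubdivC111111 D) where
  open BFSTree T

  -- Lexicographic order by level and then by `τ`, written as a number with last digit below `n`.
  -- `τ` will be `id` or `opposite`.
  key : (Fin n → Fin n) → Fin n → ℕ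
  key τ v = level v * n + toℕ (τ v)

  level<⇒key< : ∀ τ {u v} → level u < level v → key τ u < key τ v
  level<⇒key< τ {u} {v} l< = begin-strict
    level u * n + toℕ (τ u)  <⟨ +-monoʳ-< (level u * n) (toℕ<n (τ u)) ⟩
    level u * n + n          ≡⟨ +-comm (level u * n) n ⟩
    suc (level u) * n        ≤⟨ *-monoˡ-≤ n l< ⟩
    level v * n              ≤⟨ m≤m+n (level v * n) _ ⟩
    level v * n + toℕ (τ v)  ∎
    where open ≤-Reasoning

  tie⇒key< : ∀ τ {u v} → level u ≡ level v → toℕ (τ u) < toℕ (τ v) → key τ u < key τ v
  tie⇒key< τ {u} {v} l≡ t< rewrite l≡ = +-monoʳ-< (level v * n) t<

  key≤⇒level≤ : ∀ τ {u v} → key τ u ≤ key τ v → level u ≤ level v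
  key≤⇒level≤ τ k≤ = ≮⇒≥ λ l< → <⇒≱ (level<⇒key< τ l<) k≤

  module Ordered (τ : Fin n → Fin n) = Marking T (key τ) (key≤⇒level≤ τ)

  Forward : Rel (Fin n) 0ℓ
  Forward x y = level y ≡ suc (level x)

  Return : Rel (Fin n) 0ℓ
  Return x y = Arc D x y × level y ≤ level x

  forward-colourable : Colourable Forward 2
  forward-colourable = (parity ∘ level) , λ {x} {y} l≡ p≡ →
    parity-suc (level x) (trans (sym (cong parity l≡)) (sym p≡))

  opposite-< : ∀ {u v : Fin n} → toℕ u < toℕ v → toℕ (opposite v) < toℕ (opposite u)
  opposite-< {u} {v} u<v rewrite opposite-prop u | opposite-prop v = ∸-monoʳ-< (s≤s u<v) (toℕ<n v)

  -- An arc inside a level descends in the index order or in its reversal. An arc that lowers the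
  -- level descends in both orders and is put in the first class.
  return-split : ∀ {x y} → Return x y → Ordered.Backward id x y ⊎ Ordered.Backward opposite x y
  return-split {x} {y} (a , l≤) with m≤n⇒m<n∨m≡n l≤ | <-cmp (toℕ x) (toℕ y)
  ... | inj₁ l< | _ = inj₁ (a , level<⇒key< id l<)
  ... | inj₂ _ | tri≈ _ x≡y _ = contradiction (toℕ-injective x≡y) (arc⇒≢ D a)
  ... | inj₂ l≡ | tri> _ _ y<x = inj₁ (a , tie⇒key< id l≡ y<x)
  ... | inj₂ l≡ | tri< x<y _ _ = inj₂ (a , tie⇒key< opposite l≡ (opposite-< x<y))

  arc-split : ∀ {x y} → Arc D x y → Forward x y ⊎ Return x y
  arc-split a with m≤n⇒m<n∨m≡n (level-arc a)
  ... | inj₁ l< = inj₂ (a , s≤s⁻¹ l<)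
  ... | inj₂ l≡ = inj₁ l≡

  arc-colourable : Colourable (Arc D) (2 * ((3 * 4) * (3 * 4)))
  arc-colourable = colourable-⊎ arc-split forward-colourable
    (colourable-⊎ return-split (Ordered.backward-colourable id avoids)
                               (Ordered.backward-colourable opposite avoids))

theorem8 : ∀ (n : ℕ) (D : Digraph n) → StronglyConnected D →
    ¬ ContainsSubdivC111111 D → ChromaticAtMost D (7 * 16 ^ 2)
theorem8 zero D _ _ = (λ ()) , λ ()
theorem8 (suc n) D strong avoids =
  -- 288 = 2 · 12 · 12 and 1792 = 7 · 16². Strong connectivity makes vertex `zero` a root that
  -- reaches every vertex.
  let c , proper = colourable-≤ {R = Arc D} (≤ᵇ⇒≤ 288 1792 _)
        (Colouring.arc-colourable (BFS.tree D zero (strong zero)) avoids)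
  in c , λ _ _ → proper
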